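{- If $E$ is a semi-decidable IC equivalence relation on $\mathbb{N}$, then there are decidable IC equivalence relations $F$ and $G$ on $\mathbb{N}$ such that $E = FGF = F \vee G$.
   Context: $\mathbb{N}=\{0,1,2,\dots\}$. Relations are subsets of $\mathbb{N}\times\mathbb{N}$. "Decidable" means recursive (the characteristic function is computable); "semi-decidable" means recursively enumerable. An equivalence relation on $\mathbb{N}$ is called IC if every one of its equivalence classes is infinite. The composition of binary relations is $RS=\{(x,z) : \exists y\, [(x,y)\in R \text{ and } (y,z)\in S]\}$. $F\vee G$ denotes the join in the lattice of equivalence relations, i.e. the transitive closure of $F\cup G$. -}

module Defs where

open import Data.Fin.Base using (Fin)
open import Data.Nat.Base using (ℕ; zero; suc; _<_)
open import Data.Product.Base using (Σ; ∃; ∃₂; _×_; _,_)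
open import Data.Sum.Base using (_⊎_)
open import Data.Vec.Base using (Vec; []; _∷_; lookup)
open import Data.Vec.Relation.Binary.Pointwise.Inductive using (Pointwise)
open import Function.Bundles using (_⇔_)
open import Level using (Level; _⊔_)
open import Relation.Binary.Core using (Rel)
open import Relation.Binary.Construct.Closure.Transitive using (TransClosure)
open import Relation.Binary.Construct.Composition public
  using () renaming (_;_ to _⨾_)
open import Relation.Binary.Construct.Union using (_∪_)
open import Relation.Binary.PropositionalEquality.Core using (_≡_)
open import Relation.Binary.Structures using (IsEquivalence)
open import Relation.Nullary.Negation.Core using (¬_)
open import Relation.Unary using (Pred)

private
  variable
    m n : ℕ
    a ℓ ℓ₁ ℓ₂ : Level

-- Kleene's partial recursive functions: n-ary terms, and their big-step
-- semantics as a relation, so that divergence is the absence of a value.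

data Rec : ℕ → Set where
  zero : Rec n
  succ : Rec 1
  proj : Fin n → Rec n
  comp : Rec m → Vec (Rec n) m → Rec n
  prec : Rec n → Rec (suc (suc n)) → Rec (suc n)
  min  : Rec (suc n) → Rec n

infix 4 _[_]⇓_

data _[_]⇓_ : Rec n → Vec ℕ n → ℕ → Set where
  zero⇓ : ∀ {xs : Vec ℕ n} → zero [ xs ]⇓ 0
  succ⇓ : ∀ {x} → succ [ x ∷ [] ]⇓ suc x
  proj⇓ : ∀ {i} {xs : Vec ℕ n} → proj i [ xs ]⇓ lookup xs i
  comp⇓ : ∀ {f : Rec m} {gs : Vec (Rec n) m} {xs ys z} →
          Pointwise (λ g y → g [ xs ]⇓ y) gs ys →
          f [ ys ]⇓ z →
          comp f gs [ xs ]⇓ z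
  prec-zero⇓ : ∀ {f : Rec n} {g xs z} →
               f [ xs ]⇓ z →
               prec f g [ zero ∷ xs ]⇓ z
  prec-suc⇓  : ∀ {f : Rec n} {g k xs y z} →
               prec f g [ k ∷ xs ]⇓ y →
               g [ k ∷ y ∷ xs ]⇓ z →
               prec f g [ suc k ∷ xs ]⇓ z
  -- The search diverges if f is undefined somewhere below its first zero.
  min⇓ : ∀ {f : Rec (suc n)} {xs k} →
         (∀ i → i < k → ∃ λ y → f [ i ∷ xs ]⇓ suc y) →
         f [ k ∷ xs ]⇓ 0 →
         min f [ xs ]⇓ k

Recursive : (Vec ℕ n → ℕ) → Set
Recursive {n} f = Σ (Rec n) λ e → ∀ xs → e [ xs ]⇓ f xs

IsCharacteristicFunction : (Vec ℕ 2 → ℕ) → Rel ℕ ℓ → Set ℓ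
IsCharacteristicFunction χ R =
  ∀ x y → (R x y × χ (x ∷ y ∷ []) ≡ 1) ⊎ (¬ R x y × χ (x ∷ y ∷ []) ≡ 0)

-- Not the library's Decidable, which does not ask the decision procedure to
-- be a recursive function.

RecDecidable : Rel ℕ ℓ → Set ℓ
RecDecidable R = ∃ λ χ → Recursive χ × IsCharacteristicFunction χ R

-- Empty, or the range of a total recursive function ℕ → ℕ × ℕ, given by its
-- two coordinates.

SemiDecidable : Rel ℕ ℓ → Set ℓ
SemiDecidable R =
  (∀ x y → ¬ R x y) ⊎
  (∃₂ λ (f g : Vec ℕ 1 → ℕ) → Recursive f × Recursive g ×
     (∀ x y → R x y ⇔ ∃ λ k → f (k ∷ []) ≡ x × g (k ∷ []) ≡ y))

-- Unboundedness is the constructive form of infinity for sets of naturals;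
-- the library's Inf is its double-negated weakening.

Infinite : Pred ℕ ℓ → Set ℓ
Infinite P = ∀ b → ∃ λ y → b < y × P y

IsIC : Rel ℕ ℓ → Set ℓ
IsIC R = IsEquivalence R × (∀ x → Infinite (R x))

infixr 6 _∨_

_∨_ : {A : Set a} → Rel A ℓ₁ → Rel A ℓ₂ → Rel A (a ⊔ ℓ₁ ⊔ ℓ₂)
F ∨ G = TransClosure (F ∪ G)

{-# OPTIONS --safe #-}

-- Let (f s, g s) enumerate E.  Since E is IC, one can search effectively for
-- an element of the class of f s above any bound; so there is a recursive,
-- strictly increasing sequence of markers such that the s-th marker a lies in
-- the class of f s and exceeds both f s and g s.  Let F be generated by the
-- links (a, f s) and G by the links (a, g s).  The markers form a decidable set
-- and each link leads downwards, so F and G are decided by comparing the roots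
-- reached by following links.  Both are contained in E, and f s F a G g s, so
-- that already E = FG.  The F-class of x is infinite because E x y holds for
-- arbitrarily large y, and each such pair yields a marker above y linked to x.

module Submission where

open import Defs
open import Data.Fin.Base using (Fin; zero; suc)
open import Data.Nat.Base
open import Data.Nat.GeneralisedArithmetic using (fold; iterate; iterate-is-fold)
open import Data.Nat.Properties
open import Data.Product.Base using (∃; ∃₂; _×_; _,_; proj₁; proj₂)
open import Data.Sum.Base using (inj₁; inj₂)
open import Data.Vec.Base using (Vec; []; _∷_; lookup; map)
open import Data.Vec.Relation.Binary.Pointwise.Inductive using (Pointwise; []; _∷_)
open import Data.Vec.Relation.Unary.All using (All; []; _∷_)
open import Function.Base using (_∘_; _on_)
open import Function.Bundles using (Equivalence)
open import Level using (0ℓ)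
open import Relation.Binary.Construct.Closure.Transitive using ([_]; _∷_)
open import Relation.Binary.Core using (Rel; _⇔_; _⇒_)
import Relation.Binary.Construct.On as On
open import Relation.Binary.Construct.Union using (_∪_)
open import Relation.Binary.PropositionalEquality
  using (_≡_; refl; sym; trans; cong; cong₂; subst; isEquivalence; module ≡-Reasoning)
open import Relation.Binary.Structures using (IsEquivalence)
open import Relation.Nullary.Decidable.Core using (yes; no)
open import Relation.Nullary.Negation.Core using (contradiction)

private
  variable
    m n : ℕ

-- Closure properties of the recursive functions

Recursive-resp-≗ : {f g : Vec ℕ n → ℕ} → (∀ xs → f xs ≡ g xs) →
                   Recursive f → Recursive g
Recursive-resp-≗ f≗g (e , e⇓) = e , λ xs → subst (e [ xs ]⇓_) (f≗g xs) (e⇓ xs)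

Recursive-lookup : (i : Fin n) → Recursive (λ xs → lookup xs i)
Recursive-lookup i = proj i , λ _ → proj⇓

Recursive-zero : Recursive {n} (λ _ → 0)
Recursive-zero = zero , λ _ → zero⇓

Recursive-∘ : {f : Vec ℕ m → ℕ} {gs : Vec (Vec ℕ n → ℕ) m} →
              Recursive f → All Recursive gs →
              Recursive (λ xs → f (map (λ g → g xs) gs))
Recursive-∘ (e , e⇓) rs =
  comp e (codes rs) , λ xs → comp⇓ (values rs xs) (e⇓ _)
  where
  codes : ∀ {k} {gs : Vec (Vec ℕ n → ℕ) k} → All Recursive gs → Vec (Rec n) k
  codes []             = []
  codes ((c , _) ∷ rs) = c ∷ codes rs

  values : ∀ {k} {gs : Vec (Vec ℕ n → ℕ) k} (rs : All Recursive gs) xs →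
           Pointwise (λ c y → c [ xs ]⇓ y) (codes rs) (map (λ g → g xs) gs)
  values []              xs = []
  values ((_ , c⇓) ∷ rs) xs = c⇓ xs ∷ values rs xs

-- Taking `h` as given lets a function defined by ordinary recursion be certified by its recursion
-- equation, often just `refl`.
Recursive-prec : {h : Vec ℕ (suc n) → ℕ} {step : Vec ℕ (suc (suc n)) → ℕ} →
                 Recursive (λ xs → h (0 ∷ xs)) → Recursive step →
                 (∀ k xs → step (k ∷ h (k ∷ xs) ∷ xs) ≡ h (suc k ∷ xs)) →
                 Recursive h
Recursive-prec {h = h} (b , b⇓) (s , s⇓) step≡ =
  prec b s , λ { (k ∷ xs) → value k xs }
  where
  value : ∀ k xs → prec b s [ k ∷ xs ]⇓ h (k ∷ xs)
  value zero    xs = prec-zero⇓ (b⇓ xs)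
  value (suc k) xs =
    prec-suc⇓ (value k xs) (subst (s [ _ ]⇓_) (step≡ k xs) (s⇓ _))

-- `below` exhibits successors because that is the form `min⇓` demands.
record LeastZero (φ : ℕ → ℕ) : Set where
  field
    index  : ℕ
    isZero : φ index ≡ 0
    below  : ∀ i → i < index → ∃ λ y → φ i ≡ suc y

leastZero : (φ : ℕ → ℕ) → (∃ λ k → φ k ≡ 0) → LeastZero φ
leastZero φ (k , φk≡0) = search k φ φk≡0
  where
  -- The known zero `k` bounds the search; shifting `φ` by one lowers it.
  search : ∀ k φ → φ k ≡ 0 → LeastZero φ
  search k φ φk≡0 with φ 0 in φ0≡
  ... | zero = record { index = 0 ; isZero = φ0≡ ; below = λ _ () }
  search zero    φ φk≡0 | suc y = contradiction (trans (sym φ0≡) φk≡0) λ ()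
  search (suc k) φ φk≡0 | suc y = record
    { index  = suc index
    ; isZero = isZero
    ; below  = λ { zero _ → y , φ0≡ ; (suc i) i< → below i (s<s⁻¹ i<) }
    }
    where open LeastZero (search k (φ ∘ suc) φk≡0)

Recursive-min : {φ : Vec ℕ (suc n) → ℕ} → Recursive φ →
                (least : ∀ xs → LeastZero (λ k → φ (k ∷ xs))) →
                Recursive (λ xs → LeastZero.index (least xs))
Recursive-min (e , e⇓) least = min e , λ xs →
  let open LeastZero (least xs) in
  min⇓ (λ i i< → let y , φi≡ = below i i< in y , subst (e [ _ ]⇓_) φi≡ (e⇓ _))
       (subst (e [ _ ]⇓_) isZero (e⇓ _))

Recursive₁ : (ℕ → ℕ) → Set
Recursive₁ f = Recursive {1} λ xs → f (lookup xs zero)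

Recursive₂ : (ℕ → ℕ → ℕ) → Set
Recursive₂ f = Recursive {2} λ xs → f (lookup xs zero) (lookup xs (suc zero))

apply₁ : (f : ℕ → ℕ) {u : Vec ℕ n → ℕ} →
         Recursive₁ f → Recursive u → Recursive (λ xs → f (u xs))
apply₁ f rf ru = Recursive-∘ rf (ru ∷ [])

apply₂ : (f : ℕ → ℕ → ℕ) {u v : Vec ℕ n → ℕ} →
         Recursive₂ f → Recursive u → Recursive v → Recursive (λ xs → f (u xs) (v xs))
apply₂ f rf ru rv = Recursive-∘ rf (ru ∷ rv ∷ [])

swap₂ : (f : ℕ → ℕ → ℕ) → Recursive₂ f → Recursive₂ (λ x y → f y x)
swap₂ f rf = apply₂ f rf (Recursive-lookup (suc zero)) (Recursive-lookup zero)

Recursive-suc : Recursive₁ suc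
Recursive-suc = succ , λ { (x ∷ []) → succ⇓ }

Recursive-+ : Recursive₂ _+_
Recursive-+ = Recursive-prec (Recursive-lookup zero)
  (apply₁ suc Recursive-suc (Recursive-lookup (suc zero))) (λ _ _ → refl)

Recursive-pred : Recursive₁ pred
Recursive-pred = Recursive-prec Recursive-zero (Recursive-lookup zero) (λ _ _ → refl)

-- Truncated subtraction recurs on the subtrahend, but `prec` on the first argument, so the flipped
-- function is treated and swapped back.
Recursive-∸ : Recursive₂ _∸_
Recursive-∸ = swap₂ (λ y x → x ∸ y) (Recursive-prec (Recursive-lookup zero)
  (apply₁ pred Recursive-pred (Recursive-lookup (suc zero)))
  (λ k xs → pred[m∸n]≡m∸[1+n] (lookup xs zero) k))

∸+∸≡∣-∣ : ∀ x y → (x ∸ y) + (y ∸ x) ≡ ∣ x - y ∣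
∸+∸≡∣-∣ zero    zero    = refl
∸+∸≡∣-∣ zero    (suc y) = refl
∸+∸≡∣-∣ (suc x) zero    = +-identityʳ (suc x)
∸+∸≡∣-∣ (suc x) (suc y) = ∸+∸≡∣-∣ x y

Recursive-∣-∣ : Recursive₂ ∣_-_∣
Recursive-∣-∣ = Recursive-resp-≗ (λ xs → ∸+∸≡∣-∣ (lookup xs zero) _)
  (apply₂ _+_ Recursive-+ Recursive-∸ (swap₂ _∸_ Recursive-∸))

ifZero : ℕ → ℕ → ℕ → ℕ
ifZero zero    x y = x
ifZero (suc _) x y = y

Recursive-ifZero : {c u v : Vec ℕ n → ℕ} →
                   Recursive c → Recursive u → Recursive v →
                   Recursive (λ xs → ifZero (c xs) (u xs) (v xs))
Recursive-ifZero rc ru rv = Recursive-∘ {f = branch} branch-rec (rc ∷ ru ∷ rv ∷ [])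
  where
  branch : Vec ℕ 3 → ℕ
  branch xs = ifZero (lookup xs zero) (lookup xs (suc zero)) (lookup xs (suc (suc zero)))

  branch-rec : Recursive branch
  branch-rec = Recursive-prec (Recursive-lookup zero)
    -- The step sees predecessor, previous value and the two branches; index 3 is the nonzero
    -- branch.
    (Recursive-lookup (suc (suc (suc zero)))) (λ _ _ → refl)

-- Equivalence relations given by descending links

module Links (p : ℕ → ℕ) (p≤ : ∀ x → p x ≤ x) where

  -- Every link that moves goes strictly down, so `x` steps from `x` are enough to reach a fixed
  -- point.
  root : ℕ → ℕ
  root x = fold x p x

  SameRoot : Rel ℕ 0ℓ
  SameRoot = _≡_ on root

  iterate-fixed : ∀ {x} → p x ≡ x → ∀ k → iterate p x k ≡ x
  iterate-fixed px≡x zero    = refl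
  iterate-fixed px≡x (suc k) = trans (cong (λ y → iterate p y k) px≡x) (iterate-fixed px≡x k)

  -- Either `x` is fixed, or its link leads to a smaller number, for which one step fewer suffices.
  -- `iterate`, unlike `fold`, peels off the first step, as this induction needs.
  iterate-stable : ∀ k l {x} → x ≤ k → x ≤ l → iterate p x k ≡ iterate p x l
  iterate-stable k l {x} x≤k x≤l with p x ≟ x
  ... | yes px≡x = trans (iterate-fixed px≡x k) (sym (iterate-fixed px≡x l))
  iterate-stable zero    l       z≤n x≤l | no px≢x = contradiction (n≤0⇒n≡0 (p≤ 0)) px≢x
  iterate-stable (suc k) zero    x≤k z≤n | no px≢x = contradiction (n≤0⇒n≡0 (p≤ 0)) px≢x
  iterate-stable (suc k) (suc l) x≤k x≤l | no px≢x =
    iterate-stable k l (s≤s⁻¹ (<-≤-trans px<x x≤k)) (s≤s⁻¹ (<-≤-trans px<x x≤l))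
    where px<x = ≤∧≢⇒< (p≤ _) px≢x

  link : ∀ x → SameRoot (p x) x
  link x = begin
    root (p x)            ≡⟨ iterate-is-fold (p x) p (p x) ⟩
    -- Raising the count to `x` gives `iterate p (p x) x`, which is `iterate p x (suc x)` by
    -- definition.
    iterate p (p x) (p x) ≡⟨ iterate-stable (p x) x ≤-refl (p≤ x) ⟩
    iterate p x (suc x)   ≡⟨ iterate-stable (suc x) x (n≤1+n x) ≤-refl ⟩
    iterate p x x         ≡⟨ iterate-is-fold x p x ⟨
    root x                ∎
    where open ≡-Reasoning

  sameRoot-isEquivalence : IsEquivalence SameRoot
  sameRoot-isEquivalence = On.isEquivalence root isEquivalence

  module _ {E : Rel ℕ 0ℓ} (isEq : IsEquivalence E) (E-link : ∀ x → E x (p x)) where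
    private module E = IsEquivalence isEq

    E-root : ∀ x → E x (root x)
    E-root x = E-fold x
      where
      E-fold : ∀ k → E x (fold x p k)
      E-fold zero    = E.refl
      E-fold (suc k) = E.trans (E-fold k) (E-link _)

    sameRoot⇒ : SameRoot ⇒ E
    sameRoot⇒ {x} {y} eq = E.trans (E-root x) (subst (λ z → E z y) (sym eq) (E.sym (E-root y)))

  sameRoot-decidable : Recursive₁ p → RecDecidable SameRoot
  sameRoot-decidable rp = χ , Recursive-χ , isChar
    where
    χ : Vec ℕ 2 → ℕ
    χ xs = ifZero ∣ root (lookup xs zero) - root (lookup xs (suc zero)) ∣ 1 0

    Recursive-fold : Recursive₂ (λ k x → fold x p k)
    Recursive-fold = Recursive-prec (Recursive-lookup zero)
      (apply₁ p rp (Recursive-lookup (suc zero))) (λ _ _ → refl)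

    Recursive-root : Recursive₁ root
    Recursive-root = apply₂ (λ k x → fold x p k) Recursive-fold
      (Recursive-lookup zero) (Recursive-lookup zero)

    Recursive-χ : Recursive χ
    Recursive-χ = Recursive-ifZero
      (apply₂ ∣_-_∣ Recursive-∣-∣
        (apply₁ root Recursive-root (Recursive-lookup zero))
        (apply₁ root Recursive-root (Recursive-lookup (suc zero))))
      (apply₁ suc Recursive-suc Recursive-zero) Recursive-zero

    isChar : IsCharacteristicFunction χ SameRoot
    isChar x y with ∣ root x - root y ∣ in eq
    ... | zero  = inj₁ (∣m-n∣≡0⇒m≡n eq , refl)
    ... | suc d = inj₂ ((λ same → contradiction (trans (sym eq) (m≡n⇒∣m-n∣≡0 same)) λ ()) , refl)

-- Markers of an enumerated IC equivalence relation

module MarkerLinks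
  {E : Rel ℕ 0ℓ} (isEq : IsEquivalence E)
  (marker stage : ℕ → ℕ) (rm : Recursive₁ marker) (rs : Recursive₁ stage)
  (stage-marker : ∀ s → stage (marker s) ≡ s)
  (φ : ℕ → ℕ) (rφ : Recursive₁ φ)
  (φ<marker : ∀ s → φ s < marker s) (E-φ : ∀ s → E (marker s) (φ s))
  where

  -- As `stage` is a left inverse of `marker`, the distance vanishes exactly when `x` is a marker;
  -- all other numbers stay fixed.
  target : ℕ → ℕ
  target x = ifZero ∣ x - marker (stage x) ∣ (φ (stage x)) x

  target-marker : ∀ s → target (marker s) ≡ φ s
  target-marker s rewrite stage-marker s | ∣n-n∣≡0 (marker s) = refl

  -- Serves twice: for the descent that `Links` requires and for containment in `E`.
  target-elim : (P : ℕ → ℕ → Set) → (∀ s → P (marker s) (φ s)) → (∀ x → P x x) →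
                ∀ x → P x (target x)
  target-elim P Pφ Prefl x with ∣ x - marker (stage x) ∣ in eq
  ... | zero  = subst (λ y → P y (φ (stage x))) (sym (∣m-n∣≡0⇒m≡n eq)) (Pφ (stage x))
  ... | suc _ = Prefl x

  Recursive-target : Recursive₁ target
  Recursive-target = Recursive-ifZero
    (apply₂ ∣_-_∣ Recursive-∣-∣ x (apply₁ marker rm (apply₁ stage rs x)))
    (apply₁ φ rφ (apply₁ stage rs x)) x
    where x = Recursive-lookup zero

  open Links target (target-elim (λ x y → y ≤ x) (<⇒≤ ∘ φ<marker) (λ _ → ≤-refl)) public

  target⇒E : SameRoot ⇒ E
  target⇒E = sameRoot⇒ isEq (target-elim E E-φ (λ _ → IsEquivalence.refl isEq))

  link-marker : ∀ s → SameRoot (φ s) (marker s)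
  link-marker s = subst (λ y → SameRoot y (marker s)) (target-marker s) (link (marker s))

  sameRoot-isIC : (∀ x b → ∃ λ s → φ s ≡ x × b < marker s) → IsIC SameRoot
  sameRoot-isIC cofinal = sameRoot-isEquivalence , λ x b →
    let s , φs≡x , b< = cofinal x b
    in marker s , b< , subst (λ y → SameRoot y (marker s)) φs≡x (link-marker s)

  decidable : RecDecidable SameRoot
  decidable = sameRoot-decidable Recursive-target

-- The two factors and their composition

module Factorisation
  {E : Rel ℕ 0ℓ} (ic : IsIC E) (f g : ℕ → ℕ) (rf : Recursive₁ f) (rg : Recursive₁ g)
  (E-enum : ∀ s → E (f s) (g s)) (enum : ∀ {x y} → E x y → ∃ λ s → f s ≡ x × g s ≡ y)
  (marker stage : ℕ → ℕ) (rm : Recursive₁ marker) (rs : Recursive₁ stage)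
  (stage-marker : ∀ s → stage (marker s) ≡ s) (E-marker : ∀ s → E (f s) (marker s))
  (f<marker : ∀ s → f s < marker s) (g<marker : ∀ s → g s < marker s)
  where

  private module E = IsEquivalence (proj₁ ic)

  module F = MarkerLinks (proj₁ ic) marker stage rm rs stage-marker
    f rf f<marker (λ s → E.sym (E-marker s))
  module G = MarkerLinks (proj₁ ic) marker stage rm rs stage-marker
    g rg g<marker (λ s → E.trans (E.sym (E-marker s)) (E-enum s))

  F-isIC : IsIC F.SameRoot
  F-isIC = F.sameRoot-isIC λ x b →
    let y , b<y , Exy   = proj₂ ic x b
        s , fs≡x , gs≡y = enum Exy
    in s , fs≡x , <-trans (subst (b <_) (sym gs≡y) b<y) (g<marker s)

  -- As for `F` with the roles exchanged: the large class member now occurs as `f s`, below the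
  -- marker.
  G-isIC : IsIC G.SameRoot
  G-isIC = G.sameRoot-isIC λ y b →
    let x , b<x , Eyx   = proj₂ ic y b
        s , fs≡x , gs≡y = enum (E.sym Eyx)
    in s , gs≡y , <-trans (subst (b <_) (sym fs≡x) b<x) (f<marker s)

  E⇒FGF : E ⇒ (F.SameRoot ⨾ G.SameRoot ⨾ F.SameRoot)
  E⇒FGF Exy with enum Exy
  -- The marker already gives FG; the last F step is reflexivity at `g s`.
  ... | s , refl , refl = marker s , F.link-marker s , g s , sym (G.link-marker s) , refl

  FGF⇒F∨G : (F.SameRoot ⨾ G.SameRoot ⨾ F.SameRoot) ⇒ (F.SameRoot ∨ G.SameRoot)
  FGF⇒F∨G (u , xFu , v , uGv , vFy) =
    _∷_ {y = u} (inj₁ xFu) (_∷_ {y = v} (inj₂ uGv) [ inj₁ vFy ])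

  F∪G⇒E : (F.SameRoot ∪ G.SameRoot) ⇒ E
  F∪G⇒E (inj₁ xFy) = F.target⇒E xFy
  F∪G⇒E (inj₂ xGy) = G.target⇒E xGy

  F∨G⇒E : (F.SameRoot ∨ G.SameRoot) ⇒ E
  F∨G⇒E [ xy ]     = F∪G⇒E xy
  F∨G⇒E (xy ∷ yz) = E.trans (F∪G⇒E xy) (F∨G⇒E yz)

  factors : ∃₂ λ (F G : Rel ℕ 0ℓ) →
    RecDecidable F × IsIC F ×
    RecDecidable G × IsIC G ×
    (E ⇔ (F ⨾ G ⨾ F)) × ((F ⨾ G ⨾ F) ⇔ (F ∨ G))
  factors =
    F.SameRoot , G.SameRoot , F.decidable , F-isIC , G.decidable , G-isIC ,
    -- Three inclusions in a cycle yield both equalities.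
    (E⇒FGF , λ xy → F∨G⇒E (FGF⇒F∨G xy)) , (FGF⇒F∨G , λ xy → E⇒FGF (F∨G⇒E xy))

-- Recursive choice of the markers

module Markers
  {E : Rel ℕ 0ℓ} (ic : IsIC E) (f g : ℕ → ℕ) (rf : Recursive₁ f) (rg : Recursive₁ g)
  (E-enum : ∀ s → E (f s) (g s)) (enum : ∀ {x y} → E x y → ∃ λ s → f s ≡ x × g s ≡ y)
  where

  private module E = IsEquivalence (proj₁ ic)

  -- The sum stands in for a maximum: exceeding it exceeds all three terms.
  bound : ℕ → ℕ → ℕ
  bound s b = b + f s + g s

  -- Vanishes at k exactly when f k = f s and bound s b < g k.
  defect : ℕ → ℕ → ℕ → ℕ
  defect k s b = ∣ f k - f s ∣ + (suc (bound s b) ∸ g k)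

  fresh : ∀ s b → LeastZero (λ k → defect k s b)
  fresh s b = leastZero _ witness
    where
    witness : ∃ λ k → defect k s b ≡ 0
    witness =
      -- The infinite class of `f s` has a member above the bound, and the enumeration lists it
      -- paired with `f s`.
      let y , b<y , Efy  = proj₂ ic (f s) (bound s b)
          k , fk≡ , gk≡y  = enum Efy
      in k , cong₂ _+_ (m≡n⇒∣m-n∣≡0 fk≡) (m≤n⇒m∸n≡0 (subst (bound s b <_) (sym gk≡y) b<y))

  next : ℕ → ℕ → ℕ
  next s b = g (LeastZero.index (fresh s b))

  E-next : ∀ s b → E (f s) (next s b)
  E-next s b = subst (λ x → E x (next s b)) (∣m-n∣≡0⇒m≡n (m+n≡0⇒m≡0 _ isZero)) (E-enum index)
    where open LeastZero (fresh s b)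

  bound<next : ∀ s b → bound s b < next s b
  bound<next s b = m∸n≡0⇒m≤n (m+n≡0⇒n≡0 ∣ f index - f s ∣ isZero)
    where open LeastZero (fresh s b)

  -- The index is shifted so that `marker⁻ s` is what the marker of stage `s` must exceed; the
  -- initial 0 is a bound, not a marker.
  marker⁻ : ℕ → ℕ
  marker⁻ zero    = 0
  marker⁻ (suc s) = next s (marker⁻ s)

  marker : ℕ → ℕ
  marker s = marker⁻ (suc s)

  E-marker : ∀ s → E (f s) (marker s)
  E-marker s = E-next s (marker⁻ s)

  f<marker : ∀ s → f s < marker s
  f<marker s = ≤-<-trans (≤-trans (m≤n+m (f s) (marker⁻ s)) (m≤m+n _ (g s))) (bound<next s _)

  g<marker : ∀ s → g s < marker s
  g<marker s = ≤-<-trans (m≤n+m (g s) _) (bound<next s (marker⁻ s))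

  marker-step : ∀ s → marker⁻ s < marker s
  marker-step s =
    ≤-<-trans (≤-trans (m≤m+n (marker⁻ s) (f s)) (m≤m+n _ (g s))) (bound<next s _)

  n≤marker⁻ : ∀ n → n ≤ marker⁻ n
  n≤marker⁻ zero    = z≤n
  n≤marker⁻ (suc n) = ≤-<-trans (n≤marker⁻ n) (marker-step n)

  marker⁻-mono-≤′ : ∀ {s t} → s ≤′ t → marker⁻ s ≤ marker⁻ t
  marker⁻-mono-≤′ ≤′-refl         = ≤-refl
  marker⁻-mono-≤′ (≤′-step s≤′t) = ≤-trans (marker⁻-mono-≤′ s≤′t) (<⇒≤ (marker-step _))

  marker-mono-< : ∀ {s t} → s < t → marker s < marker t
  -- `s < t` unfolds to `suc s ≤ t`, and `marker s` to `marker⁻ (suc s)`.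
  marker-mono-< s<t = ≤-<-trans (marker⁻-mono-≤′ (≤⇒≤′ s<t)) (marker-step _)

  -- Finds the first marker at or above `x`; the search ends because `marker x` exceeds `x`.
  stageZero : ∀ x → LeastZero (λ s → x ∸ marker s)
  stageZero x = leastZero _
    (x , m≤n⇒m∸n≡0 (≤-trans (n≤marker⁻ x) (<⇒≤ (marker-step x))))

  stage : ℕ → ℕ
  stage x = LeastZero.index (stageZero x)

  -- Markers strictly increase, so the first one that is at least `marker s` is `marker s` itself.
  stage-marker : ∀ s → stage (marker s) ≡ s
  stage-marker s = ≤-antisym (≮⇒≥ not-below) (≮⇒≥ not-above)
    where
    open LeastZero (stageZero (marker s))

    not-below : stage (marker s) ≯ s
    not-below s< = let _ , eq = below s s< in contradiction (trans (sym (n∸n≡0 (marker s))) eq) λ ()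

    not-above : stage (marker s) ≮ s
    not-above <s = <⇒≱ (marker-mono-< <s) (m∸n≡0⇒m≤n isZero)

  Recursive-marker : Recursive₁ marker
  Recursive-marker = apply₁ marker⁻ Recursive-marker⁻ Recursive-suc
    where
    defectᵥ : Vec ℕ 3 → ℕ
    defectᵥ xs = defect (lookup xs zero) (lookup xs (suc zero)) (lookup xs (suc (suc zero)))

    Recursive-defect : Recursive defectᵥ
    Recursive-defect = apply₂ _+_ Recursive-+
      (apply₂ ∣_-_∣ Recursive-∣-∣ (apply₁ f rf k) (apply₁ f rf s))
      (apply₂ _∸_ Recursive-∸
        (apply₁ suc Recursive-suc
          (apply₂ _+_ Recursive-+ (apply₂ _+_ Recursive-+ b (apply₁ f rf s)) (apply₁ g rg s)))
        (apply₁ g rg k))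
      where
      k = Recursive-lookup zero
      s = Recursive-lookup (suc zero)
      b = Recursive-lookup (suc (suc zero))

    Recursive-next : Recursive₂ next
    Recursive-next = apply₁ g rg (Recursive-min {φ = defectᵥ} Recursive-defect
      (λ xs → fresh (lookup xs zero) (lookup xs (suc zero))))

    Recursive-marker⁻ : Recursive₁ marker⁻
    -- `next` takes the stage and then the previous value, the argument order of a `prec` step.
    Recursive-marker⁻ = Recursive-prec Recursive-zero Recursive-next (λ _ _ → refl)

  Recursive-stage : Recursive₁ stage
  Recursive-stage = Recursive-min
    {φ = λ xs → lookup xs (suc zero) ∸ marker (lookup xs zero)}
    (apply₂ _∸_ Recursive-∸ (Recursive-lookup (suc zero))
      (apply₁ marker Recursive-marker (Recursive-lookup zero)))
    (λ xs → stageZero (lookup xs zero))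

  open Factorisation ic f g rf rg E-enum enum marker stage Recursive-marker Recursive-stage
    stage-marker E-marker f<marker g<marker public using (factors)

proposition4 : (E : Rel ℕ 0ℓ) → SemiDecidable E → IsIC E →
    ∃₂ λ (F G : Rel ℕ 0ℓ) →
    RecDecidable F × IsIC F ×
    RecDecidable G × IsIC G ×
    (E ⇔ (F ⨾ G ⨾ F)) × ((F ⨾ G ⨾ F) ⇔ (F ∨ G))
proposition4 E (inj₁ empty) (isEq , _) = contradiction (IsEquivalence.refl isEq) (empty 0 0)
proposition4 E (inj₂ (f , g , rf , rg , enum)) ic = factors
  where
  open Markers ic (λ s → f (s ∷ [])) (λ s → g (s ∷ []))
    -- A vector variable of length 1 is not definitionally `lookup xs zero ∷ []`, hence the
    -- composition with a projection.
    (Recursive-∘ rf (Recursive-lookup zero ∷ []))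
    (Recursive-∘ rg (Recursive-lookup zero ∷ []))
    (λ s → Equivalence.from (enum _ _) (s , refl , refl))
    (Equivalence.to (enum _ _))
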